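{- Let $n \geq 1$ and let $G$ be the hypertree $HT(n)$. Then the locating-domination number of $G$ is $$\gamma^{L}(G) = \begin{cases} \frac{1}{5}(2^{n+2}+1) & \text{if } n\equiv 0 \pmod 4,\\ \frac{1}{5}(2^{n+2}+2) & \text{if } n\equiv 1 \pmod 4,\\ \frac{1}{5}(2^{n+2}-1) & \text{if } n\equiv 2 \pmod 4,\\ \frac{1}{5}(2^{n+2}-2) & \text{if } n\equiv 3 \pmod 4.\end{cases}$$
   Context: The hypertree $HT(n)$ has vertex set $\{1,2,\dots,2^{n+1}-1\}$. Its edges are the edges of the complete binary tree of height $n$ in which vertex $x$ has children $2x$ and $2x+1$ (the root is $1$, at level $0$; vertex $v$ lies at level $i$ iff $2^i \le v \le 2^{i+1}-1$), together with horizontal edges: for each level $i\ge 1$, two vertices at level $i$ are adjacent if their labels differ by $2^{i-1}$. A locating-dominating set of $G$ is a set $S\subseteq V(G)$ such that every vertex of $V(G)\setminus S$ is adjacent to some vertex of $S$, and for every two distinct vertices $u,v\in V(G)\setminus S$, $N(u)\cap S\neq N(v)\cap S$ (where $N(x)$ is the open neighborhood). $\gamma^{L}(G)$ is the minimum cardinality of a locating-dominating set. -}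

module Defs where

open import Data.Nat using (ℕ; zero; suc; _+_; _*_; _∸_; _^_; _≤_; _<_)
open import Data.Product using (Σ; ∃; _×_)
open import Data.Sum using (_⊎_)
open import Data.List using (List; length)
open import Data.List.Membership.Propositional using (_∈_; _∉_)
open import Data.List.Relation.Unary.All using (All)
open import Data.List.Relation.Unary.Any using (Any)
open import Data.List.Relation.Unary.Unique.Propositional using (Unique)
open import Relation.Binary.PropositionalEquality using (_≡_; _≢_)
open import Relation.Nullary using (¬_)
open import Function.Bundles using (_⇔_)

Vertex : ℕ → ℕ → Set
Vertex n v = 1 ≤ v × v < 2 ^ (suc n)

AtLevel : ℕ → ℕ → Set
AtLevel i v = 2 ^ i ≤ v × v < 2 ^ (suc i)

TreeEdge : ℕ → ℕ → Set
TreeEdge u v = (v ≡ 2 * u ⊎ v ≡ 2 * u + 1) ⊎ (u ≡ 2 * v ⊎ u ≡ 2 * v + 1)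

-- horizontal edge at level i = suc j ≥ 1: labels differ by 2^(i-1) = 2^j
HorizEdge : ℕ → ℕ → Set
HorizEdge u v = ∃ λ j → AtLevel (suc j) u × AtLevel (suc j) v ×
                        (v ≡ u + 2 ^ j ⊎ u ≡ v + 2 ^ j)

Adj : ℕ → ℕ → ℕ → Set
Adj n u v = Vertex n u × Vertex n v × (TreeEdge u v ⊎ HorizEdge u v)

IsLocDom : ℕ → List ℕ → Set
IsLocDom n S =
  Unique S × All (Vertex n) S ×
  (∀ v → Vertex n v → v ∉ S → Any (λ s → Adj n s v) S) ×
  (∀ u v → Vertex n u → Vertex n v → u ∉ S → v ∉ S → u ≢ v →
     ¬ (∀ s → s ∈ S → (Adj n s u ⇔ Adj n s v)))

LocDomNumber : ℕ → ℕ → Set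
LocDomNumber n k =
  (Σ (List ℕ) λ S → IsLocDom n S × length S ≡ k) ×
  (∀ S → IsLocDom n S → k ≤ length S)

{-# OPTIONS --safe #-}

-- Work with the number L = n + 1 of levels and K = 2 ^ L, and let γ be given by γ(L) = L for L ≤ 3
-- and γ(L + 4) = γ(L) + 6 K.
--
-- Lower bound.  The last three levels of the hypertree with L + 4 levels split into K prisms over a
-- binary tree of height 2 (14 vertices), and a locating-dominating set S has at least 6 elements in
-- each of them, whatever it does elsewhere.  Replacing the elements of S on level L by their parents
-- turns the rest of S into a locating-dominating set for the first L levels.
--
-- Upper bound.  To a set for the first L levels add all of level L + 1 and, on level L + 3, the even
-- labels of the left half and the odd labels of the right half.

module Submission where

open import Defs
open import Data.Bool as Bool using (Bool; true; false; T; not; _∧_; _∨_; if_then_else_)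
open import Data.Bool.ListAction using (or; and)
open import Data.Bool.Properties using (T-∧; not-involutive)
open import Data.Empty using (⊥; ⊥-elim)
open import Data.List using (List; []; _∷_; length; map; filter; upTo; applyUpTo)
open import Data.List.Membership.Propositional using (_∈_; _∉_; find; lose)
open import Data.List.Membership.Propositional.Properties using (∈-filter⁺; ∈-filter⁻; ∈-upTo⁺; ∈-upTo⁻)
open import Data.List.Relation.Unary.All as All using (All; []; _∷_)
open import Data.List.Relation.Unary.Unique.Propositional.Properties using (filter⁺; upTo⁺)
open import Data.Nat using (ℕ; zero; suc; _+_; _*_; _∸_; _^_; _≤_; _<_; _%_; _/_; z≤n; s≤s; _<?_; _≤ᵇ_; _<ᵇ_; _≡ᵇ_; _≟_)
open import Data.Nat.DivMod using (m≡m%n+[m/n]*n; m*n/n≡m)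
open import Data.Nat.Properties hiding (_≟_; _<?_)
open import Data.Nat.Tactic.RingSolver using (solve-∀)
open import Data.Product using (∃; _×_; _,_; proj₁; proj₂)
open import Data.Sum using (_⊎_; inj₁; inj₂; [_,_]′)
open import Data.Unit using (tt)
open import Data.Vec using (Vec; []; _∷_)
open import Function using (_∘_; id; case_of_)
open import Function.Bundles using (_⇔_; mk⇔; Equivalence)
open import Relation.Binary.PropositionalEquality
open import Relation.Nullary using (Dec; ¬_; yes; no; does; contradiction)
open import Data.List.Membership.DecPropositional _≟_ using (_∈?_)

-- Sums over initial segments

Σ< : ℕ → (ℕ → ℕ) → ℕ
Σ< zero    f = 0
Σ< (suc n) f = f 0 + Σ< n (f ∘ suc)

Σ-cong : ∀ n {f g} → (∀ i → i < n → f i ≡ g i) → Σ< n f ≡ Σ< n g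
Σ-cong zero    h = refl
Σ-cong (suc n) h = cong₂ _+_ (h 0 (s≤s z≤n)) (Σ-cong n λ i i<n → h (suc i) (s≤s i<n))

Σ-mono : ∀ n {f g} → (∀ i → i < n → f i ≤ g i) → Σ< n f ≤ Σ< n g
Σ-mono zero    h = z≤n
Σ-mono (suc n) h = +-mono-≤ (h 0 (s≤s z≤n)) (Σ-mono n λ i i<n → h (suc i) (s≤s i<n))

Σ-const : ∀ n c → Σ< n (λ _ → c) ≡ n * c
Σ-const zero    c = refl
Σ-const (suc n) c = cong (c +_) (Σ-const n c)

Σ-distrib-+ : ∀ n f g → Σ< n (λ i → f i + g i) ≡ Σ< n f + Σ< n g
Σ-distrib-+ zero    f g = refl
Σ-distrib-+ (suc n) f g = begin
  f 0 + g 0 + Σ< n (λ i → f (suc i) + g (suc i))       ≡⟨ cong (f 0 + g 0 +_) (Σ-distrib-+ n _ _) ⟩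
  f 0 + g 0 + (Σ< n (f ∘ suc) + Σ< n (g ∘ suc))        ≡⟨ interchange (f 0) (g 0) _ _ ⟩
  f 0 + Σ< n (f ∘ suc) + (g 0 + Σ< n (g ∘ suc))        ∎
  where
  open ≡-Reasoning
  interchange : ∀ a b c d → a + b + (c + d) ≡ a + c + (b + d)
  interchange = solve-∀

Σ-split : ∀ m n f → Σ< (m + n) f ≡ Σ< m f + Σ< n (λ i → f (m + i))
Σ-split zero    n f = refl
Σ-split (suc m) n f = trans (cong (f 0 +_) (Σ-split m n (f ∘ suc))) (sym (+-assoc (f 0) _ _))

-- For `K = 2 ^ i` the labels summed over are exactly those of level `i` of the tree.
level : ℕ → (ℕ → ℕ) → ℕ
level K f = Σ< K (λ i → f (K + i))

children : (ℕ → ℕ) → ℕ → ℕ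
children f u = f (2 * u) + f (2 * u + 1)

Σ-double : ∀ K f → Σ< (2 * K) f ≡ Σ< K f + level K f
Σ-double K f = trans (cong (λ k → Σ< (K + k) f) (+-identityʳ K)) (Σ-split K K f)

Σ-children : ∀ K f → Σ< (2 * K) f ≡ Σ< K (children f)
Σ-children zero    f = refl
Σ-children (suc K) f = begin
  Σ< (2 * suc K) f                               ≡⟨ cong (λ k → Σ< k f) (*-suc 2 K) ⟩
  f 0 + (f 1 + Σ< (2 * K) (f ∘ suc ∘ suc))       ≡⟨ sym (+-assoc (f 0) _ _) ⟩
  f 0 + f 1 + Σ< (2 * K) (f ∘ suc ∘ suc)         ≡⟨ cong (f 0 + f 1 +_) (Σ-children K _) ⟩
  f 0 + f 1 + Σ< K (children (f ∘ suc ∘ suc))    ≡⟨ cong (f 0 + f 1 +_) (Σ-cong K λ i _ → shift i) ⟩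
  f 0 + f 1 + Σ< K (children f ∘ suc)            ∎
  where
  open ≡-Reasoning
  shift : ∀ i → children (f ∘ suc ∘ suc) i ≡ children f (suc i)
  shift i = cong₂ _+_ (cong f (sym (*-suc 2 i))) (cong (λ k → f (k + 1)) (sym (*-suc 2 i)))

level-children : ∀ K f → level (2 * K) f ≡ level K (children f)
level-children K f = trans (Σ-children K _) (Σ-cong K λ i _ →
  cong₂ _+_ (cong f (ev i)) (cong f (od i)))
  where
  ev : ∀ i → 2 * K + 2 * i ≡ 2 * (K + i)
  ev i = sym (*-distribˡ-+ 2 K i)
  od : ∀ i → 2 * K + (2 * i + 1) ≡ 2 * (K + i) + 1
  od i = trans (sym (+-assoc (2 * K) _ 1)) (cong (_+ 1) (ev i))

-- With `K = 2 ^ L` the labels `2 * K + i` and `3 * K + i` are horizontal neighbours on level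
-- `L + 1`: the left half of the level is matched with the right half.
level-twins : ∀ K f → level (2 * K) f ≡ Σ< K (λ i → f (2 * K + i) + f (3 * K + i))
level-twins K f = begin
  level (2 * K) f                                         ≡⟨ Σ-double K _ ⟩
  Σ< K (λ i → f (2 * K + i)) + Σ< K (λ i → f (2 * K + (K + i)))
    ≡⟨ cong (Σ< K (λ i → f (2 * K + i)) +_) (Σ-cong K λ i _ → cong f (assoc K i)) ⟩
  Σ< K (λ i → f (2 * K + i)) + Σ< K (λ i → f (3 * K + i)) ≡⟨ sym (Σ-distrib-+ K _ _) ⟩
  Σ< K (λ i → f (2 * K + i) + f (3 * K + i))              ∎
  where
  open ≡-Reasoning
  assoc : ∀ K i → 2 * K + (K + i) ≡ 3 * K + i
  assoc = solve-∀

-- The weight of a binary tree of height 2: the root, two children and, in the last summand, four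
-- grandchildren. Two such trees with horizontally adjacent roots make up one prism.
block : (ℕ → ℕ) → ℕ → ℕ
block f u = f u + children f u + children (children f) u

-- With `K = 2 ^ L` the three summands are the first `L` levels, level `L`, and the last three of
-- `L + 4` levels, grouped into `K` prisms by their pairs of roots on level `L + 1`.
Σ-blocks : ∀ K f → Σ< (2 * (2 * (2 * (2 * K)))) f ≡
  Σ< K f + level K f + Σ< K (λ i → block f (2 * K + i) + block f (3 * K + i))
Σ-blocks K f = begin
  Σ< (2 * (2 * (2 * (2 * K)))) f
    ≡⟨ Σ-double (2 * (2 * (2 * K))) f ⟩
  Σ< (2 * (2 * (2 * K))) f + level (2 * (2 * (2 * K))) f
    ≡⟨ cong₂ _+_ (Σ-double (2 * (2 * K)) f)
         (trans (level-children (2 * (2 * K)) f) (level-children (2 * K) (children f))) ⟩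
  Σ< (2 * (2 * K)) f + level (2 * (2 * K)) f + level (2 * K) f₂
    ≡⟨ cong (_+ level (2 * K) f₂) (cong₂ _+_ (Σ-double (2 * K) f) (level-children (2 * K) f)) ⟩
  Σ< (2 * K) f + level (2 * K) f + level (2 * K) f₁ + level (2 * K) f₂
    ≡⟨ assoc (Σ< (2 * K) f) (level (2 * K) f) _ _ ⟩
  Σ< (2 * K) f + (level (2 * K) f + level (2 * K) f₁ + level (2 * K) f₂)
    ≡⟨ cong₂ _+_ (Σ-double K f) (trans (cong (_+ level (2 * K) f₂) (sym (Σ-distrib-+ (2 * K) _ _)))
         (sym (Σ-distrib-+ (2 * K) _ _))) ⟩
  Σ< K f + level K f + level (2 * K) (block f)
    ≡⟨ cong (Σ< K f + level K f +_) (level-twins K (block f)) ⟩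
  Σ< K f + level K f + Σ< K (λ i → block f (2 * K + i) + block f (3 * K + i)) ∎
  where
  open ≡-Reasoning
  f₁ = children f
  f₂ = children f₁
  assoc : ∀ a b c d → a + b + c + d ≡ a + (b + c + d)
  assoc = solve-∀

-- Parents, children and horizontal neighbours

data Child (p c : ℕ) : Set where
  even : c ≡ 2 * p → Child p c
  odd  : c ≡ 2 * p + 1 → Child p c

-- The labels 0 and 1 both get the value 0, which is not a vertex.
parent : ∀ v → ∃ λ p → Child p v
parent zero = 0 , even refl
parent (suc v) with parent v
... | p , even refl = p , odd (+-comm 1 _)
... | p , odd refl = suc p , even (trans (cong suc (+-comm (2 * p) 1)) (sym (*-suc 2 p)))

2p+1≡ : ∀ p → 2 * p + 1 ≡ suc (2 * p)
2p+1≡ p = +-comm (2 * p) 1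

child-≥ : ∀ {p c y} → Child p c → y ≤ p → 2 * y ≤ c
child-≥ (even refl) y≤p = *-monoʳ-≤ 2 y≤p
child-≥ (odd refl) y≤p = ≤-trans (*-monoʳ-≤ 2 y≤p) (m≤m+n _ 1)

child-< : ∀ {p c y} → Child p c → p < y → c < 2 * y
child-< (even refl) p<y = *-monoʳ-< 2 p<y
child-< {p} {y = y} (odd refl) p<y = begin-strict
  2 * p + 1     <⟨ ≤-reflexive (trans (cong suc (2p+1≡ p)) (sym (*-suc 2 p))) ⟩
  2 * suc p     ≤⟨ *-monoʳ-≤ 2 p<y ⟩
  2 * y         ∎
  where open ≤-Reasoning

child-≥⁻¹ : ∀ {p c y} → Child p c → 2 * y ≤ c → y ≤ p
child-≥⁻¹ ch 2y≤c = ≮⇒≥ λ p<y → <⇒≱ (child-< ch p<y) 2y≤c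

child-<⁻¹ : ∀ {p c y} → Child p c → c < 2 * y → p < y
child-<⁻¹ ch c<2y = ≰⇒> λ y≤p → <⇒≱ c<2y (child-≥ ch y≤p)

child-injective : ∀ {p p′ c} → Child p c → Child p′ c → p ≡ p′
child-injective {p} {p′} ch ch′ =
  ≤-antisym (≮⇒≥ (sep ch′ ch)) (≮⇒≥ (sep ch ch′))
  where
  sep : ∀ {a b c} → Child a c → Child b c → ¬ (a < b)
  sep cha chb a<b = <⇒≱ (child-< cha a<b) (child-≥ chb ≤-refl)

siblings-≢ : ∀ p → 2 * p ≢ 2 * p + 1
siblings-≢ p eq = m≢1+m+n (2 * p) {0} (trans eq (trans (2p+1≡ p) (cong suc (sym (+-identityʳ _)))))

record Twin (j u v : ℕ) : Set where
  constructor twin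
  field
    levelˡ : AtLevel (suc j) u
    levelʳ : AtLevel (suc j) v
    gap    : v ≡ u + 2 ^ j ⊎ u ≡ v + 2 ^ j

twin-sym : ∀ {j u v} → Twin j u v → Twin j v u
twin-sym (twin lu lv (inj₁ e)) = twin lv lu (inj₂ e)
twin-sym (twin lu lv (inj₂ e)) = twin lv lu (inj₁ e)

2^-mono : ∀ {i j} → i ≤ j → 2 ^ i ≤ 2 ^ j
2^-mono = ^-monoʳ-≤ 2

2^-cancel-< : ∀ {i j} → 2 ^ i < 2 ^ j → i < j
2^-cancel-< {i} {j} lt = ≰⇒> λ j≤i → <⇒≱ lt (2^-mono j≤i)

1≤2^ : ∀ j → 1 ≤ 2 ^ j
1≤2^ j = 2^-mono {0} {j} z≤n

level-unique : ∀ {i j v} → AtLevel i v → AtLevel j v → i ≡ j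
level-unique {i} {j} (a , b) (c , d) = ≤-antisym
  (≤-pred (2^-cancel-< {i} {suc j} (≤-<-trans a d))) (≤-pred (2^-cancel-< {j} {suc i} (≤-<-trans c b)))

upper-bound : ∀ {K u v} → 2 * K ≤ v → u ≡ v + K → 3 * K ≤ u
upper-bound {K} 2K≤v refl = ≤-trans (≤-reflexive (+-comm K (2 * K))) (+-monoˡ-≤ K 2K≤v)

lower-bound : ∀ {K u v} → v < 2 * (2 * K) → v ≡ u + K → u < 3 * K
lower-bound {K} {u} v< refl = +-cancelʳ-< K u (3 * K) (<-≤-trans v< (≤-reflexive (eq K)))
  where
  eq : ∀ K → 2 * (2 * K) ≡ 3 * K + K
  eq = solve-∀

-- With `K = 2 ^ j`, level `j + 1` is cut in half at `3 * K`. From the left half a step of length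
-- `K` can only go up, from the right half only down, so two steps in opposite directions from the
-- same label are impossible.
twin-unique : ∀ {j u v w} → Twin j u v → HorizEdge w u → w ≡ v
twin-unique {j} (twin lu lv e) (i , lw , lu′ , e′) with level-unique {suc i} {suc j} lu′ lu
... | refl with e | e′
... | inj₁ p | inj₂ q = trans q (sym p)
... | inj₂ p | inj₁ q = +-cancelʳ-≡ (2 ^ j) _ _ (trans (sym q) p)
... | inj₁ p | inj₁ q = contradiction (upper-bound (proj₁ lw) q) (<⇒≱ (lower-bound (proj₂ lv) p))
... | inj₂ p | inj₂ q = contradiction (upper-bound (proj₁ lv) p) (<⇒≱ (lower-bound (proj₂ lw) q))

twin-≢ : ∀ {j u v} → Twin j u v → u ≢ v
twin-≢ {j} (twin _ _ (inj₁ e)) refl = <⇒≢ (m<m+n _ (1≤2^ j)) e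
twin-≢ {j} (twin _ _ (inj₂ e)) refl = <⇒≢ (m<m+n _ (1≤2^ j)) e

twin-exists : ∀ {j v} → AtLevel (suc j) v → ∃ λ v′ → Twin j v v′
twin-exists {j} {v} (lo , hi) with v <? 3 * 2 ^ j
... | yes v<3K = v + K , twin (lo , hi) (≤-trans lo (m≤m+n v K) ,
                   <-≤-trans (+-monoˡ-< K v<3K) (≤-reflexive (eq K))) (inj₁ refl)
  where
  K = 2 ^ j
  eq : ∀ K → 3 * K + K ≡ 2 * (2 * K)
  eq = solve-∀
... | no v≮3K = v ∸ K , twin (lo , hi) (+-cancelʳ-≤ K _ _ (≤-trans (≤-reflexive (+-comm (2 * K) K))
                  (≤-trans (≮⇒≥ v≮3K) (≤-reflexive e))) , ≤-<-trans (m∸n≤m v K) hi) (inj₂ e)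
  where
  K = 2 ^ j
  e : v ≡ v ∸ K + K
  e = sym (m∸n+n≡m (≤-trans (m≤m+n K _) lo))

private
  even-+ : ∀ u K {v} → v ≡ u + K → 2 * v ≡ 2 * u + 2 * K
  even-+ u K refl = *-distribˡ-+ 2 u K

  odd-+ : ∀ u K {v} → v ≡ u + K → 2 * v + 1 ≡ 2 * u + 1 + 2 * K
  odd-+ u K refl = eq u K
    where
    eq : ∀ u K → 2 * (u + K) + 1 ≡ 2 * u + 1 + 2 * K
    eq = solve-∀

level-child : ∀ i {p c} → Child p c → AtLevel i p → AtLevel (suc i) c
level-child i ch (lo , hi) = child-≥ ch lo , child-< ch hi

-- Doubling the labels doubles the gap, as does descending one level. Hence the trees below two
-- horizontal neighbours are joined vertex by vertex into a prism.
twin-even : ∀ {j u v} → Twin j u v → Twin (suc j) (2 * u) (2 * v)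
twin-even {j} {u} {v} (twin lu lv e) = twin (level-child (suc j) (even refl) lu) (level-child (suc j) (even refl) lv)
  ([ inj₁ ∘ even-+ u (2 ^ j) , inj₂ ∘ even-+ v (2 ^ j) ]′ e)

twin-odd : ∀ {j u v} → Twin j u v → Twin (suc j) (2 * u + 1) (2 * v + 1)
twin-odd {j} {u} {v} (twin lu lv e) = twin (level-child (suc j) (odd refl) lu) (level-child (suc j) (odd refl) lv)
  ([ inj₁ ∘ odd-+ u (2 ^ j) , inj₂ ∘ odd-+ v (2 ^ j) ]′ e)

-- Hypertrees with L levels

Edge : ℕ → ℕ → Set
Edge u v = TreeEdge u v ⊎ HorizEdge u v

-- The horizontal edges form a matching on each level, which leaves a vertex only its parent, its
-- one twin and its children as possible neighbours.
edge-cases : ∀ {j v v′ w} → Twin j v v′ → Edge w v → Child w v ⊎ w ≡ v′ ⊎ Child v w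
edge-cases t (inj₁ (inj₁ c)) = inj₁ ([ even , odd ]′ c)
edge-cases t (inj₁ (inj₂ c)) = inj₂ (inj₂ ([ even , odd ]′ c))
edge-cases t (inj₂ h)        = inj₂ (inj₁ (twin-unique t h))

edge-sym : ∀ {u v} → Edge u v → Edge v u
edge-sym (inj₁ (inj₁ c))    = inj₁ (inj₂ c)
edge-sym (inj₁ (inj₂ c))    = inj₁ (inj₁ c)
edge-sym (inj₂ (j , lu , lv , e)) = inj₂ (j , lv , lu , [ inj₂ , inj₁ ]′ e)

-- HT(n) has n + 1 levels; here L counts levels, so that L = 0 is the empty graph.
V : ℕ → ℕ → Set
V L v = 1 ≤ v × v < 2 ^ L

A : ℕ → ℕ → ℕ → Set
A L u v = V L u × V L v × Edge u v

Same : ℕ → (ℕ → Bool) → ℕ → ℕ → Set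
Same L s u v = ∀ w → s w ≡ true → A L w u ⇔ A L w v

child-edge : ∀ {u v} → Child u v → Edge u v
child-edge (even e) = inj₁ (inj₁ (inj₁ e))
child-edge (odd e)  = inj₁ (inj₁ (inj₂ e))

twin-edge : ∀ {j u v} → Twin j u v → Edge u v
twin-edge {j} (twin lu lv e) = inj₂ (j , lu , lv , e)

same-sym : ∀ {L s u v} → Same L s u v → Same L s v u
same-sym h w sw = mk⇔ (Equivalence.from (h w sw)) (Equivalence.to (h w sw))

-- s is not required to be supported on the vertices: other values only enlarge its count.
record LD (L : ℕ) (s : ℕ → Bool) : Set where
  field
    dom : ∀ v → V L v → s v ≡ false → ∃ λ u → s u ≡ true × A L u v
    loc : ∀ u v → V L u → V L v → s u ≡ false → s v ≡ false → u ≢ v → ¬ Same L s u v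

χ : Bool → ℕ
χ false = 0
χ true  = 1

V-level : ∀ i {L v} → suc i ≤ L → AtLevel i v → V L v
V-level i i<L (lo , hi) = ≤-trans (1≤2^ i) lo , <-≤-trans hi (2^-mono i<L)

-- The lower bound

-- Turns a refutation of "all these labels are outside `s`" into a Boolean clause, the form in which
-- `hexagon-check` takes its hypotheses.
clause : ∀ (s : ℕ → Bool) xs → ¬ All (λ x → s x ≡ false) xs → T (or (map s xs))
clause s []       h = h []
clause s (x ∷ xs) h with s x in eq
... | true  = tt
... | false = clause s xs (h ∘ (eq ∷_))

-- Keeps the two halves of the clause apart, so that each can be matched with the bound for its own
-- hexagon in `blocks-≥6`.
∨-clause : ∀ (s : ℕ → Bool) xs ys → (All (λ x → s x ≡ false) xs → ¬ All (λ x → s x ≡ false) ys) →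
  T (or (map s xs) ∨ or (map s ys))
∨-clause s []       ys h = clause s ys (h [])
∨-clause s (x ∷ xs) ys h with s x in eq
... | true  = tt
... | false = ∨-clause s xs ys (h ∘ (eq ∷_))

T-and : ∀ {bs} → All T bs → T (and bs)
T-and []                  = tt
T-and (_∷_ {true} _ ts) = T-and ts

everywhere : ∀ n → (Vec Bool n → Bool) → Bool
everywhere zero    f = f []
everywhere (suc n) f = everywhere n (f ∘ (false ∷_)) ∧ everywhere n (f ∘ (true ∷_))

everywhere-sound : ∀ n f → T (everywhere n f) → ∀ v → T (f v)
everywhere-sound zero    f t [] = t
everywhere-sound (suc n) f t (false ∷ v) = everywhere-sound n _ (proj₁ (Equivalence.to T-∧ t)) v
everywhere-sound (suc n) f t (true ∷ v)  = everywhere-sound n _ (proj₂ (Equivalence.to T-∧ t)) v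

-- A hexagon is a pair of twins m, m′ above the leaves a, b and a′, b′; q, q′ are the parents of m, m′.
hexagon-clauses : Vec Bool 8 → List Bool
hexagon-clauses (m ∷ m′ ∷ a ∷ b ∷ a′ ∷ b′ ∷ q ∷ q′ ∷ []) = map or (
  (a ∷ a′ ∷ m ∷ []) ∷ (a′ ∷ a ∷ m′ ∷ []) ∷
  (b ∷ b′ ∷ m ∷ []) ∷ (b′ ∷ b ∷ m′ ∷ []) ∷
  (a ∷ a′ ∷ b ∷ b′ ∷ []) ∷
  (m ∷ m′ ∷ q ∷ a ∷ b ∷ []) ∷ (m′ ∷ m ∷ q′ ∷ a′ ∷ b′ ∷ []) ∷
  (a′ ∷ m ∷ b ∷ q ∷ []) ∷ (b′ ∷ m ∷ a ∷ q ∷ []) ∷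
  (a ∷ m′ ∷ b′ ∷ q′ ∷ []) ∷ (b ∷ m′ ∷ a′ ∷ q′ ∷ []) ∷ [])

-- Here `c` counts the chosen vertices of the hexagon. The third bound says that if `q′` is not
-- chosen and `c` is 2, then `m`, `m′`, `a` and `b` are all unchosen, so that `m` has at most `q` as
-- a chosen neighbour; the fourth is its mirror image.
hexagon-bounds : Vec Bool 8 → List Bool
hexagon-bounds (m ∷ m′ ∷ a ∷ b ∷ a′ ∷ b′ ∷ q ∷ q′ ∷ []) =
  (2 ≤ᵇ c) ∷ (3 ≤ᵇ c + (χ q + χ q′)) ∷
  (2 + χ (or (m ∷ m′ ∷ a ∷ b ∷ []))   ≤ᵇ c + χ q′) ∷
  (2 + χ (or (m′ ∷ m ∷ a′ ∷ b′ ∷ [])) ≤ᵇ c + χ q) ∷ []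
  where
  c = χ m + (χ a + χ b) + (χ m′ + (χ a′ + χ b′))

-- Proved by evaluating the implication at all 256 truth assignments.
hexagon-check : ∀ v → T (not (and (hexagon-clauses v)) ∨ and (hexagon-bounds v))
hexagon-check = everywhere-sound 8 (λ v → not (and (hexagon-clauses v)) ∨ and (hexagon-bounds v)) tt

modus-ponens : ∀ {x y} → T (not x ∨ y) → T x → T y
modus-ponens {true} t _ = t

record Hexagon (s : ℕ → Bool) (m m′ q q′ : ℕ) : Set where
  c : ℕ
  c = χ (s m) + children (χ ∘ s) m + (χ (s m′) + children (χ ∘ s) m′)
  field
    ≥2     : 2 ≤ c
    ≥3     : 3 ≤ c + (χ (s q) + χ (s q′))
    left≥  : 2 + χ (or (map s (m ∷ m′ ∷ 2 * m ∷ 2 * m + 1 ∷ [])))     ≤ c + χ (s q′)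
    right≥ : 2 + χ (or (map s (m′ ∷ m ∷ 2 * m′ ∷ 2 * m′ + 1 ∷ []))) ≤ c + χ (s q)

-- Domination and location on the last two levels

module _ (j : ℕ) {s : ℕ → Bool} (ld : LD (3 + j) s) where
  open LD ld

  private
    L = 3 + j

    differ : ∀ {w v} {X : Set} → s w ≡ true → s v ≡ false → w ≡ v → X
    differ sw sv refl with () ← trans (sym sw) sv

    V-leaf : ∀ {x x′} → Twin (suc j) x x′ → V L x
    V-leaf t = V-level (2 + j) ≤-refl (Twin.levelˡ t)

    V-inner : ∀ {m m′} → Twin j m m′ → V L m
    V-inner t = V-level (1 + j) (n≤1+n _) (Twin.levelˡ t)

    -- The children of a label on the last level are too large to be vertices.
    leaf-nbrs : ∀ {x x′ m w} → Twin (suc j) x x′ → Child m x → A L w x → w ≡ m ⊎ w ≡ x′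
    leaf-nbrs t c ((_ , w<) , _ , e) with edge-cases t e
    ... | inj₁ c′        = inj₁ (child-injective c′ c)
    ... | inj₂ (inj₁ eq) = inj₂ eq
    ... | inj₂ (inj₂ c′) = contradiction (child-≥ c′ (proj₁ (Twin.levelˡ t))) (<⇒≱ w<)

    inner-nbrs : ∀ {m m′ q w} → Twin j m m′ → Child q m → A L w m → (w ≡ q ⊎ w ≡ m′) ⊎ Child m w
    inner-nbrs t c (_ , _ , e) with edge-cases t e
    ... | inj₁ c′        = inj₁ (inj₁ (child-injective c′ c))
    ... | inj₂ (inj₁ eq) = inj₁ (inj₂ eq)
    ... | inj₂ (inj₂ c′) = inj₂ c′

  leaf-dom : ∀ {x x′ m} → Twin (suc j) x x′ → Child m x → T (or (map s (x ∷ x′ ∷ m ∷ [])))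
  leaf-dom {x} {x′} {m} t c = clause s (x ∷ x′ ∷ m ∷ []) λ where
      (x ∷ x′ ∷ m ∷ []) → let (w , sw , a) = dom _ (V-leaf t) x in
        [ differ sw m , differ sw x′ ]′ (leaf-nbrs t c a)

  inner-dom : ∀ {m m′ q} → Twin j m m′ → Child q m →
    T (or (map s (m ∷ m′ ∷ q ∷ 2 * m ∷ 2 * m + 1 ∷ [])))
  inner-dom {m} {m′} {q} t c = clause s (m ∷ m′ ∷ q ∷ 2 * m ∷ 2 * m + 1 ∷ []) λ where
      (m ∷ m′ ∷ q ∷ a ∷ b ∷ []) → let (w , sw , adj) = dom _ (V-inner t) m in
        [ [ differ sw q , differ sw m′ ]′ , (λ where (even e) → differ sw a e ; (odd e) → differ sw b e) ]′
          (inner-nbrs t c adj)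

  -- Sibling leaves share their parent, so only their twins can tell them apart.
  leaf-leaf-loc : ∀ {x x′ y y′ m} → Twin (suc j) x x′ → Twin (suc j) y y′ → Child m x → Child m y →
    x ≢ y → T (or (map s (x ∷ x′ ∷ y ∷ y′ ∷ [])))
  leaf-leaf-loc {x} {x′} {y} {y′} t u c d x≢y = clause s (x ∷ x′ ∷ y ∷ y′ ∷ []) λ where
      (x ∷ x′ ∷ y ∷ y′ ∷ []) → loc _ _ (V-leaf t) (V-leaf u) x y x≢y λ w sw →
        mk⇔ (move t u c d x′ sw) (move u t d c y′ sw)
    where
    move : ∀ {x x′ y y′ m w} → Twin (suc j) x x′ → Twin (suc j) y y′ → Child m x → Child m y →
      s x′ ≡ false → s w ≡ true → A L w x → A L w y
    move t u c d x′ sw a with leaf-nbrs t c a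
    ... | inj₁ refl = proj₁ a , V-leaf u , child-edge d
    ... | inj₂ eq   = differ sw x′ eq

  -- The leaf a′ and the vertex m are opposite corners of the 4-cycle a′ a m m′.
  leaf-inner-loc : ∀ {a a′ b m m′ q} → Twin (suc j) a′ a → Twin j m m′ → Child m a → Child m′ a′ → Child q m →
    (∀ {w} → Child m w → w ≡ a ⊎ w ≡ b) → T (or (map s (a′ ∷ m ∷ b ∷ q ∷ [])))
  leaf-inner-loc {a} {a′} {b} {m} {m′} {q} t u c c′ d kids = clause s (a′ ∷ m ∷ b ∷ q ∷ []) λ where
      (sa′ ∷ sm ∷ sb ∷ sq ∷ []) → loc _ _ (V-leaf t) (V-inner u) sa′ sm
        (λ where refl → <⇒≱ (proj₂ (Twin.levelˡ u)) (proj₁ (Twin.levelˡ t)))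
        -- Both neighbours `a` and `m′` of `a′` are also neighbours of `m`; the remaining neighbours
        -- `b` and `q` of `m` are outside `s`.
        λ w sw → mk⇔ to (from sw sb sq)
    where
    to : ∀ {w} → A L w a′ → A L w m
    to adj with leaf-nbrs t c′ adj
    ... | inj₁ refl = proj₁ adj , V-inner u , edge-sym (twin-edge u)
    ... | inj₂ refl = proj₁ adj , V-inner u , edge-sym (child-edge c)
    from : ∀ {w} → s w ≡ true → s b ≡ false → s q ≡ false → A L w m → A L w a′
    from sw sb sq adj with inner-nbrs u d adj
    ... | inj₁ (inj₁ eq)   = differ sw sq eq
    ... | inj₁ (inj₂ refl) = proj₁ adj , V-leaf t , child-edge c′
    ... | inj₂ k with kids k
    ...   | inj₁ refl = proj₁ adj , V-leaf t , edge-sym (twin-edge t)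
    ...   | inj₂ eq   = differ sw sb eq

  -- If the clause failed, the common parent `q` would be the only possible neighbour in `s` of both
  -- siblings.
  inner-inner-loc : ∀ {m m′ n n′ q} → Twin j m m′ → Twin j n n′ → Child q m → Child q n → m ≢ n →
    T (or (map s (m ∷ m′ ∷ 2 * m ∷ 2 * m + 1 ∷ [])) ∨ or (map s (n ∷ n′ ∷ 2 * n ∷ 2 * n + 1 ∷ [])))
  inner-inner-loc {m} {m′} {n} {n′} t u c d m≢n = ∨-clause s
    (m ∷ m′ ∷ 2 * m ∷ 2 * m + 1 ∷ []) (n ∷ n′ ∷ 2 * n ∷ 2 * n + 1 ∷ []) λ where
      (sm ∷ sm′ ∷ ma ∷ mb ∷ []) (sn ∷ sn′ ∷ na ∷ nb ∷ []) → loc _ _ (V-inner t) (V-inner u) sm sn m≢n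
        λ w sw → mk⇔ (move t u c d sm′ ma mb sw) (move u t d c sn′ na nb sw)
    where
    move : ∀ {m m′ n n′ q w} → Twin j m m′ → Twin j n n′ → Child q m → Child q n →
      s m′ ≡ false → s (2 * m) ≡ false → s (2 * m + 1) ≡ false → s w ≡ true → A L w m → A L w n
    move t u c d m′ ma mb sw adj with inner-nbrs t c adj
    ... | inj₁ (inj₁ refl) = proj₁ adj , V-inner u , child-edge d
    ... | inj₁ (inj₂ eq)   = differ sw m′ eq
    ... | inj₂ (even eq)   = differ sw ma eq
    ... | inj₂ (odd eq)    = differ sw mb eq

  -- The Boolean check treats `q` and `q′` as independent, so the result also covers `q = q′`, the
  -- case of three levels in `lower₃`.
  hexagon : ∀ {m m′ q q′} → Twin j m m′ → Child q m → Child q′ m′ → Hexagon s m m′ q q′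
  hexagon {m} {m′} {q} {q′} t c c′ = record
    { ≥2     = ≤ᵇ⇒≤ _ _ (proj₁ bounds)
    ; ≥3     = ≤ᵇ⇒≤ _ _ (proj₁ (proj₂ bounds))
    ; left≥  = ≤ᵇ⇒≤ _ _ (proj₁ (proj₂ (proj₂ bounds)))
    ; right≥ = ≤ᵇ⇒≤ _ _ (proj₂ (proj₂ (proj₂ bounds)))
    }
    where
    a = twin-even t
    b = twin-odd t
    evenFirst : ∀ {m w} → Child m w → w ≡ 2 * m ⊎ w ≡ 2 * m + 1
    evenFirst (even e) = inj₁ e
    evenFirst (odd e)  = inj₂ e
    oddFirst : ∀ {m w} → Child m w → w ≡ 2 * m + 1 ⊎ w ≡ 2 * m
    oddFirst (even e) = inj₂ e
    oddFirst (odd e)  = inj₁ e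
    v = s m ∷ s m′ ∷ s (2 * m) ∷ s (2 * m + 1) ∷ s (2 * m′) ∷ s (2 * m′ + 1) ∷ s q ∷ s q′ ∷ []
    clauses : All T (hexagon-clauses v)
    clauses =
      leaf-dom a (even refl) ∷ leaf-dom (twin-sym a) (even refl) ∷
      leaf-dom b (odd refl) ∷ leaf-dom (twin-sym b) (odd refl) ∷
      leaf-leaf-loc {m = m} a b (even refl) (odd refl) (siblings-≢ m) ∷
      inner-dom t c ∷ inner-dom (twin-sym t) c′ ∷
      leaf-inner-loc (twin-sym a) t (even refl) (even refl) c evenFirst ∷
      leaf-inner-loc (twin-sym b) t (odd refl) (odd refl) c oddFirst ∷
      leaf-inner-loc a (twin-sym t) (even refl) (even refl) c′ evenFirst ∷
      leaf-inner-loc b (twin-sym t) (odd refl) (odd refl) c′ oddFirst ∷ []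
    split : ∀ {w x y z} → T (and (w ∷ x ∷ y ∷ z ∷ [])) → T w × T x × T y × T z
    split {true} {true} {true} {true} _ = tt , tt , tt , tt
    bounds = split (modus-ponens (hexagon-check v) (T-and clauses))

-- If q and q′ are both in s, or both outside, the bounds ≥2 and ≥3 suffice; if only q′ is, two
-- hexagons with two elements each would leave q′ as the only neighbour in s of two vertices.
blocks-≥6 : ∀ L {s} → LD (4 + L) s → ∀ {q q′} → Twin L q q′ → 6 ≤ block (χ ∘ s) q + block (χ ∘ s) q′
blocks-≥6 L {s} ld {q} {q′} t = ≤-trans
  (bound (s q) (s q′) H₁.≥2 H₂.≥2 H₁.≥3 H₂.≥3
    (extra _ _ H₁.c H₂.c (χ (s q′)) H₁.left≥ H₂.left≥
      (inner-inner-loc (suc L) ld {q = q} t₁ t₂ (even refl) (odd refl) (siblings-≢ q)))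
    (extra _ _ H₁.c H₂.c (χ (s q)) H₁.right≥ H₂.right≥
      (inner-inner-loc (suc L) ld {q = q′} (twin-sym t₁) (twin-sym t₂) (even refl) (odd refl) (siblings-≢ q′))))
  (≤-reflexive (regroup (f q) (f q′) (f (2 * q)) (f (2 * q + 1)) (f (2 * q′)) (f (2 * q′ + 1))
    (children f (2 * q)) (children f (2 * q + 1)) (children f (2 * q′)) (children f (2 * q′ + 1))))
  where
  f = χ ∘ s
  -- The prism consists of the roots `q`, `q′` and two hexagons, one above the even children of the
  -- roots and one above the odd ones.
  t₁ = twin-even t
  t₂ = twin-odd t
  module H₁ = Hexagon (hexagon (suc L) ld {q = q} {q′ = q′} t₁ (even refl) (even refl))
  module H₂ = Hexagon (hexagon (suc L) ld {q = q} {q′ = q′} t₂ (odd refl) (odd refl))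
  -- Location of the two siblings makes `y` or `z` true, which raises one of the two bounds from 2
  -- to 3. Here `e` is the weight of one root; `bound` uses the inequality for a root of weight 0.
  extra : ∀ y z c d e → 2 + χ y ≤ c + e → 2 + χ z ≤ d + e → T (y ∨ z) → 5 ≤ (c + e) + (d + e)
  extra true  _    _ _ _ p q _ = +-mono-≤ p (m+n≤o⇒m≤o 2 q)
  extra false true _ _ _ p q _ = +-mono-≤ p q
  bound : ∀ x y {c d} → 2 ≤ c → 2 ≤ d → 3 ≤ c + (χ x + χ y) → 3 ≤ d + (χ x + χ y) →
    5 ≤ (c + χ y) + (d + χ y) → 5 ≤ (c + χ x) + (d + χ x) → 6 ≤ χ x + χ y + (c + d)
  bound false false {c} {d} _ _ p q _ _ =
    subst₂ (λ u v → 6 ≤ u + v) (+-identityʳ c) (+-identityʳ d) (+-mono-≤ p q)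
  bound false true  {c} {d} _ _ _ _ _ p =
    s≤s (subst₂ (λ u v → 5 ≤ u + v) (+-identityʳ c) (+-identityʳ d) p)
  bound true  false {c} {d} _ _ _ _ p _ =
    s≤s (subst₂ (λ u v → 5 ≤ u + v) (+-identityʳ c) (+-identityʳ d) p)
  bound true  true  p q _ _ _ _ = s≤s (s≤s (+-mono-≤ p q))
  regroup : ∀ x y m n m′ n′ e f e′ f′ →
    x + y + ((m + e + (m′ + e′)) + (n + f + (n′ + f′))) ≡ x + (m + n) + (e + f) + (y + (m′ + n′) + (e′ + f′))
  regroup = solve-∀

low-twin : ∀ L i → i < 2 ^ L → Twin L (2 * 2 ^ L + i) (3 * 2 ^ L + i)
low-twin L i i<K = twin
  (m≤m+n _ i , <-≤-trans (+-monoʳ-< (2 * K) i<K) (≤-trans (m≤m+n _ K) (≤-reflexive (eq K))))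
  (≤-trans (m≤n+m _ K) (m≤m+n _ i) , <-≤-trans (+-monoʳ-< (3 * K) i<K) (≤-reflexive (eq₃ K)))
  (inj₁ (eq₄ K i))
  where
  K = 2 ^ L
  eq : ∀ K → 2 * K + K + K ≡ 2 * (2 * K)
  eq = solve-∀
  eq₃ : ∀ K → 3 * K + K ≡ 2 * (2 * K)
  eq₃ = solve-∀
  eq₄ : ∀ K i → 3 * K + i ≡ 2 * K + i + K
  eq₄ = solve-∀

-- Restriction to the first L levels

V-weaken : ∀ L {v} → V L v → V (4 + L) v
V-weaken L (lo , hi) = lo , <-≤-trans hi (2^-mono (m≤n+m L 4))

A-weaken : ∀ L {u v} → A L u v → A (4 + L) u v
A-weaken L (u , v , e) = V-weaken L u , V-weaken L v , e

-- A horizontal edge stays on one level and a parent has the smaller label, so a neighbour across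
-- the boundary `2 ^ L` from below can only be a child.
upward-edge : ∀ L {w v} → v < 2 ^ L → 2 ^ L ≤ w → Edge w v → Child v w
upward-edge L {w} v< ≤w (inj₁ (inj₁ c)) = contradiction
  (≤-trans ≤w (≤-trans (m≤m+n w (w + 0)) (child-≥ {w} ([ even , odd ]′ c) ≤-refl))) (<⇒≱ v<)
upward-edge L v< ≤w (inj₁ (inj₂ c)) = [ even , odd ]′ c
upward-edge L v< ≤w (inj₂ (j , lw , lv , _)) = contradiction
  (≤-trans (2^-mono (≤-pred (2^-cancel-< {L} {2 + j} (≤-<-trans ≤w (proj₂ lw))))) (proj₁ lv)) (<⇒≱ v<)

if-< : ∀ {X : Set} {x y : X} {m n} → m < n → (if m <ᵇ n then x else y) ≡ x
if-< {m = m} {n} m<n with m <ᵇ n | <⇒<ᵇ m<n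
... | true | _ = refl

if-≥ : ∀ {X : Set} {x y : X} {m n} → n ≤ m → (if m <ᵇ n then x else y) ≡ y
if-≥ {m = m} {n} n≤m with m <ᵇ n in eq
... | false = refl
... | true  = contradiction (<ᵇ⇒< m n (subst T (sym eq) tt)) (≤⇒≯ n≤m)

module _ (L : ℕ) (s : ℕ → Bool) where
  private K = 2 ^ L

  -- Cutting off the labels below `K` makes `contract` move only elements of level `L` to their
  -- parents, and not elements of the levels above.
  lifted : ℕ → Bool
  lifted w = if w <ᵇ K then false else s w

  contract : ℕ → Bool
  contract v = s v ∨ (lifted (2 * v) ∨ lifted (2 * v + 1))

  ∨-false : ∀ {x y} → x ∨ y ≡ false → x ≡ false × y ≡ false
  ∨-false {false} e = refl , e

  contract-⊇ : ∀ v → s v ≡ true → contract v ≡ true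
  contract-⊇ v sv rewrite sv = refl

  contract-child : ∀ {v w} → contract v ≡ false → K ≤ w → Child v w → s w ≡ false
  contract-child {v} e K≤w c with ∨-false {s v} e
  ... | _ , e′ with ∨-false {lifted (2 * v)} e′ | c
  ... | e₀ , _ | even refl = trans (sym (if-≥ K≤w)) e₀
  ... | _ , e₁ | odd refl  = trans (sym (if-≥ K≤w)) e₁

  -- Each element of level `L` is charged to its one parent: the children of the labels below `K`
  -- are the labels below `2 * K`, and on the first half of these `lifted` vanishes.
  contract-count : Σ< K (χ ∘ contract) ≤ Σ< K (χ ∘ s) + level K (χ ∘ s)
  contract-count = begin
    Σ< K (χ ∘ contract)                                  ≤⟨ Σ-mono K (λ v _ → χ-∨ (s v) (lifted (2 * v)) (lifted (2 * v + 1))) ⟩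
    Σ< K (λ v → χ (s v) + children (χ ∘ lifted) v)       ≡⟨ Σ-distrib-+ K _ _ ⟩
    Σ< K (χ ∘ s) + Σ< K (children (χ ∘ lifted))          ≡⟨ cong (Σ< K (χ ∘ s) +_) (sym (Σ-children K (χ ∘ lifted))) ⟩
    Σ< K (χ ∘ s) + Σ< (2 * K) (χ ∘ lifted)               ≡⟨ cong (Σ< K (χ ∘ s) +_) (Σ-double K (χ ∘ lifted)) ⟩
    Σ< K (χ ∘ s) + (Σ< K (χ ∘ lifted) + level K (χ ∘ lifted))
      ≡⟨ cong (Σ< K (χ ∘ s) +_) (cong₂ _+_
           (trans (Σ-cong K λ i i<K → cong χ (if-< i<K)) (trans (Σ-const K 0) (*-zeroʳ K)))
           (Σ-cong K λ i _ → cong χ (if-≥ (m≤m+n K i)))) ⟩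
    Σ< K (χ ∘ s) + level K (χ ∘ s)                       ∎
    where
    open ≤-Reasoning
    χ-∨ : ∀ x y z → χ (x ∨ (y ∨ z)) ≤ χ x + (χ y + χ z)
    χ-∨ true  _     _ = s≤s z≤n
    χ-∨ false true  _ = s≤s z≤n
    χ-∨ false false _ = ≤-refl

  -- A vertex outside `contract` has no child in `s` on level `L`, so all its neighbours in `s` lie
  -- in the first `L` levels. Since `contract` contains `s` there, it dominates, and vertices that
  -- it fails to separate would not be separated by `s` either.
  contract-LD : LD (4 + L) s → LD L contract
  contract-LD ld = record { dom = dom′ ; loc = loc′ }
    where
    open LD ld
    below : ∀ {v w} → V L v → contract v ≡ false → s w ≡ true → A (4 + L) w v → A L w v
    below {v} {w} Vv cv sw ((1≤w , _) , _ , e) with w <? K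
    ... | yes w<K = (1≤w , w<K) , Vv , e
    ... | no w≮K with () ← trans (sym sw) (contract-child cv (≮⇒≥ w≮K) (upward-edge L (proj₂ Vv) (≮⇒≥ w≮K) e))
    dom′ : ∀ v → V L v → contract v ≡ false → ∃ λ u → contract u ≡ true × A L u v
    dom′ v Vv cv =
      let (u , su , a) = dom v (V-weaken L Vv) (proj₁ (∨-false cv)) in
      u , contract-⊇ u su , below Vv cv su a
    loc′ : ∀ u v → V L u → V L v → contract u ≡ false → contract v ≡ false → u ≢ v → ¬ Same L contract u v
    loc′ u v Vu Vv cu cv u≢v same =
      loc u v (V-weaken L Vu) (V-weaken L Vv) (proj₁ (∨-false cu)) (proj₁ (∨-false cv)) u≢v λ w sw →
        let open Equivalence (same w (contract-⊇ w sw)) in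
        mk⇔ (A-weaken L ∘ to ∘ below Vu cu sw) (A-weaken L ∘ from ∘ below Vv cv sw)

-- The recursion and the lower bound for it

γ : ℕ → ℕ
γ 0 = 0
γ 1 = 1
γ 2 = 2
γ 3 = 3
γ (suc (suc (suc (suc L)))) = γ L + 2 ^ L * 6

root-isolated : ∀ {w} → ¬ HorizEdge w 1
root-isolated (j , _ , (lo , _) , _) = <⇒≱ (s≤s (s≤s z≤n)) (≤-trans (2^-mono {1} {suc j} (s≤s z≤n)) lo)

top-twin : Twin 0 2 3
top-twin = low-twin 0 0 (s≤s z≤n)

root-edge : ∀ {w} → 1 ≤ w → Edge w 1 → Child 1 w
root-edge 1≤w (inj₁ (inj₁ c)) = contradiction (child-≥ ([ even , odd ]′ c) 1≤w) λ where (s≤s ())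
root-edge 1≤w (inj₁ (inj₂ c)) = [ even , odd ]′ c
root-edge 1≤w (inj₂ h)        = contradiction h root-isolated

triangle : ∀ u v → V 2 u → V 2 v → u ≢ v → A 2 u v
triangle u v Vu Vv u≢v = Vu , Vv , go u v Vu Vv u≢v
  where
  go : ∀ u v → V 2 u → V 2 v → u ≢ v → Edge u v
  go 1 1 _ _ ne = contradiction refl ne
  go 1 2 _ _ _  = child-edge (even refl)
  go 1 3 _ _ _  = child-edge (odd refl)
  go 2 1 _ _ _  = edge-sym (child-edge (even refl))
  go 2 2 _ _ ne = contradiction refl ne
  go 2 3 _ _ _  = twin-edge top-twin
  go 3 1 _ _ _  = edge-sym (child-edge (odd refl))
  go 3 2 _ _ _  = edge-sym (twin-edge top-twin)
  go 3 3 _ _ ne = contradiction refl ne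
  go 0 _ (() , _) _ _
  go _ 0 _ (() , _) _
  go (suc (suc (suc (suc u)))) _ (_ , lt) _ _ = contradiction (m≤m+n 4 u) (<⇒≱ lt)
  go _ (suc (suc (suc (suc v)))) _ (_ , lt) _ = contradiction (m≤m+n 4 v) (<⇒≱ lt)

lower₁ : ∀ s → LD 1 s → 1 ≤ Σ< 2 (χ ∘ s)
lower₁ s ld with s 1 in eq
... | true  = m≤n+m 1 (χ (s 0))
... | false with LD.dom ld 1 (s≤s z≤n , s≤s (s≤s z≤n)) eq
...   | u , _ , (1≤u , u<2) , _ , e = contradiction (child-≥ (root-edge 1≤u e) ≤-refl) (<⇒≱ u<2)

-- In a triangle two vertices outside `s` are both adjacent to every vertex in `s`, so at most one
-- vertex is outside.
lower₂ : ∀ s → LD 2 s → 2 ≤ Σ< 4 (χ ∘ s)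
lower₂ s ld = ≤-trans (go (s 1) (s 2) (s 3) (pair 1 2 V₁ V₂ λ ()) (pair 1 3 V₁ V₃ λ ()) (pair 2 3 V₂ V₃ λ ()))
  (m≤n+m _ (χ (s 0)))
  where
  V₁ : V 2 1
  V₁ = V-level 0 {2} (s≤s z≤n) (≤-refl , ≤-refl)
  V₂ : V 2 2
  V₂ = V-level 1 {2} ≤-refl (Twin.levelˡ top-twin)
  V₃ : V 2 3
  V₃ = V-level 1 {2} ≤-refl (Twin.levelʳ top-twin)
  pair : ∀ u v → V 2 u → V 2 v → u ≢ v → s u ≡ false → s v ≡ false → ⊥
  pair u v Vu Vv u≢v su sv = LD.loc ld u v Vu Vv su sv u≢v λ w sw →
    let other = λ {x} (sx : s x ≡ false) → λ { refl → case trans (sym sw) sx of λ () } in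
    mk⇔ (λ a → triangle w v (proj₁ a) Vv (other sv)) (λ a → triangle w u (proj₁ a) Vu (other su))
  go : ∀ x y z → (x ≡ false → y ≡ false → ⊥) → (x ≡ false → z ≡ false → ⊥) → (y ≡ false → z ≡ false → ⊥) →
    2 ≤ χ x + (χ y + (χ z + 0))
  go false false _     p _ _ = contradiction refl (p refl)
  go false true  false _ p _ = contradiction refl (p refl)
  go true  false false _ _ p = contradiction refl (p refl)
  go false true  true  _ _ _ = ≤-refl
  go true  false true  _ _ _ = ≤-refl
  go true  true  _     _ _ _ = s≤s (s≤s z≤n)

-- The six vertices other than the root form a hexagon whose two upper parents are both the root. It
-- contains two elements if the root is in `s` and three if not.
lower₃ : ∀ s → LD 3 s → 3 ≤ Σ< 8 (χ ∘ s)
lower₃ s ld = ≤-trans (go (s 1) H.≥2 H.≥3) (≤-trans (m≤n+m _ (f 0))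
  (≤-reflexive (regroup (f 0) (f 1) (f 2) (f 3) (f 4) (f 5) (f 6) (f 7))))
  where
  f = χ ∘ s
  module H = Hexagon (hexagon 0 ld {q = 1} {q′ = 1} top-twin (even refl) (odd refl))
  go : ∀ x {c} → 2 ≤ c → 3 ≤ c + (χ x + χ x) → 3 ≤ χ x + c
  go true  p _ = s≤s p
  go false {c} _ p = subst (3 ≤_) (+-identityʳ c) p
  regroup : ∀ z r m n a b a′ b′ →
    z + (r + (m + (a + b) + (n + (a′ + b′)))) ≡ z + (r + (m + (n + (a + (b + (a′ + (b′ + 0)))))))
  regroup = solve-∀

lower : ∀ L s → LD L s → γ L ≤ Σ< (2 ^ L) (χ ∘ s)
lower 0 s ld = z≤n
lower 1 s ld = lower₁ s ld
lower 2 s ld = lower₂ s ld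
lower 3 s ld = lower₃ s ld
lower (suc (suc (suc (suc L)))) s ld = begin
  γ L + K * 6
    ≤⟨ +-mono-≤ (≤-trans (lower L (contract L s) (contract-LD L s ld)) (contract-count L s))
         (≤-trans (≤-reflexive (sym (Σ-const K 6))) (Σ-mono K λ i i<K → blocks-≥6 L ld (low-twin L i i<K))) ⟩
  Σ< K f + level K f + Σ< K (λ i → block f (2 * K + i) + block f (3 * K + i))
    ≡⟨ sym (Σ-blocks K f) ⟩
  Σ< (2 ^ (4 + L)) f ∎
  where
  open ≤-Reasoning
  K = 2 ^ L
  f = χ ∘ s

-- The upper bound

isEven : ℕ → Bool
isEven zero    = true
isEven (suc n) = not (isEven n)

isEven-+ : ∀ m {n} → isEven n ≡ true → isEven (m + n) ≡ isEven m
isEven-+ zero    e = e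
isEven-+ (suc m) e = cong not (isEven-+ m e)

isEven-2* : ∀ n → isEven (2 * n) ≡ true
isEven-2* zero    = refl
isEven-2* (suc n) = trans (cong isEven (*-suc 2 n)) (trans (not-involutive _) (isEven-2* n))

isEven-2*+1 : ∀ n → isEven (2 * n + 1) ≡ false
isEven-2*+1 n = trans (cong isEven (2p+1≡ n)) (cong not (isEven-2* n))

-- The powers of 2 are the boundaries of levels, and `3 * 2 ^ (2 + L)` is the middle of level
-- `L + 3`. The parity rule picks one of each two siblings and one of each two horizontal neighbours
-- on that level.
chosen : ℕ → ℕ → Bool
chosen 0 _ = false
chosen 1 v = v ≡ᵇ 1
chosen 2 v = (v ≡ᵇ 1) ∨ (v ≡ᵇ 2)
chosen 3 v = (v ≡ᵇ 1) ∨ ((v ≡ᵇ 4) ∨ (v ≡ᵇ 5))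
chosen (suc (suc (suc (suc L)))) v =
  if v <ᵇ 2 ^ L then chosen L v else
  if v <ᵇ 2 ^ (1 + L) then false else
  if v <ᵇ 2 ^ (2 + L) then true else
  if v <ᵇ 2 ^ (3 + L) then false else
  if v <ᵇ 3 * 2 ^ (2 + L) then isEven v else not (isEven v)

-- The step from L to L + 4 levels

module Step (L : ℕ) where
  private
    K = 2 ^ L
    N = 4 + L
    S = chosen N

  above : ∀ i {v} → 2 ^ suc i ≤ v → 2 ^ i ≤ v
  above i = ≤-trans (m≤m+n (2 ^ i) _)

  chosen-top : ∀ {v} → v < K → S v ≡ chosen L v
  chosen-top v<K = if-< v<K

  chosen₀ : ∀ {v} → AtLevel L v → S v ≡ false
  chosen₀ (lo , hi) = trans (if-≥ lo) (if-< hi)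

  chosen₁ : ∀ {v} → AtLevel (1 + L) v → S v ≡ true
  chosen₁ (lo , hi) = trans (if-≥ (above L lo)) (trans (if-≥ lo) (if-< hi))

  chosen₂ : ∀ {v} → AtLevel (2 + L) v → S v ≡ false
  chosen₂ (lo , hi) = trans (if-≥ (above L lo₁)) (trans (if-≥ lo₁) (trans (if-≥ lo) (if-< hi)))
    where lo₁ = above (1 + L) lo

  chosen₃ : ∀ {v} → AtLevel (3 + L) v →
    S v ≡ (if v <ᵇ 3 * 2 ^ (2 + L) then isEven v else not (isEven v))
  chosen₃ (lo , _) = trans (if-≥ (above L lo₁)) (trans (if-≥ lo₁) (trans (if-≥ lo₂) (if-≥ lo)))
    where
    lo₂ = above (2 + L) lo
    lo₁ = above (1 + L) lo₂

  low-leaf : ∀ {v} → AtLevel (3 + L) v → v < 3 * 2 ^ (2 + L) → S v ≡ isEven v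
  low-leaf l lt = trans (chosen₃ l) (if-< lt)

  high-leaf : ∀ {v} → AtLevel (3 + L) v → 3 * 2 ^ (2 + L) ≤ v → S v ≡ not (isEven v)
  high-leaf l ge = trans (chosen₃ l) (if-≥ ge)

  2*3* : ∀ K → 2 * (3 * K) ≡ 3 * (2 * K)
  2*3* = solve-∀

  child-<3 : ∀ {i p c} → Child p c → p < 3 * 2 ^ i → c < 3 * 2 ^ suc i
  child-<3 {i} c lt = <-≤-trans (child-< c lt) (≤-reflexive (2*3* (2 ^ i)))

  child-≥3 : ∀ {i p c} → Child p c → 3 * 2 ^ i ≤ p → 3 * 2 ^ suc i ≤ c
  child-≥3 {i} c ge = ≤-trans (≤-reflexive (sym (2*3* (2 ^ i)))) (child-≥ c ge)

  leaf-child : ∀ {u} → AtLevel (2 + L) u → ∃ λ l → Child u l × S l ≡ true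
  leaf-child {u} lu with u <? 3 * 2 ^ (1 + L)
  ... | yes u< = 2 * u , even refl ,
          trans (low-leaf (level-child (2 + L) c lu) (child-<3 {1 + L} c u<)) (isEven-2* u)
    where
    c : Child u (2 * u)
    c = even refl
  ... | no u≮ = 2 * u + 1 , odd refl ,
          trans (high-leaf (level-child (2 + L) c lu) (child-≥3 {1 + L} c (≮⇒≥ u≮))) (cong not (isEven-2*+1 u))
    where
    c : Child u (2 * u + 1)
    c = odd refl

  -- The gap `2 ^ (2 + L)` is even, so twins have the same parity, while the rule is reversed
  -- between the two halves.
  leaf-twin : ∀ {x x′} → Twin (2 + L) x x′ → S x ≡ false → S x′ ≡ true
  leaf-twin {x} {x′} (twin lx lx′ gap) Sx with gap
  ... | inj₁ refl = begin
    S x′             ≡⟨ high-leaf lx′ (upper-bound (proj₁ lx) refl) ⟩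
    not (isEven x′)  ≡⟨ cong not (isEven-+ x {2 ^ (2 + L)} (isEven-2* (2 * K))) ⟩
    not (isEven x)   ≡⟨ cong not (sym (low-leaf lx (lower-bound (proj₂ lx′) refl))) ⟩
    not (S x)        ≡⟨ cong not Sx ⟩
    true             ∎
    where open ≡-Reasoning
  ... | inj₂ refl = begin
    S x′                 ≡⟨ low-leaf lx′ (lower-bound (proj₂ lx) refl) ⟩
    isEven x′            ≡⟨ sym (isEven-+ x′ {2 ^ (2 + L)} (isEven-2* (2 * K))) ⟩
    isEven x             ≡⟨ sym (not-involutive (isEven x)) ⟩
    not (not (isEven x)) ≡⟨ cong not (sym (high-leaf lx (upper-bound (proj₁ lx′) refl))) ⟩
    not (S x)            ≡⟨ cong not Sx ⟩
    true                 ∎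
    where open ≡-Reasoning

  data Band (v : ℕ) : Set where
    top    : v < K → Band v
    level₀ : AtLevel L v → Band v
    level₁ : AtLevel (1 + L) v → Band v
    level₂ : AtLevel (2 + L) v → Band v
    level₃ : AtLevel (3 + L) v → Band v

  band : ∀ {v} → V N v → Band v
  band {v} (_ , hi) with v <? K
  ... | yes p = top p
  ... | no p with v <? 2 ^ (1 + L)
  ...   | yes q = level₀ (≮⇒≥ p , q)
  ...   | no q with v <? 2 ^ (2 + L)
  ...     | yes r = level₁ (≮⇒≥ q , r)
  ...     | no r with v <? 2 ^ (3 + L)
  ...       | yes t = level₂ (≮⇒≥ r , t)
  ...       | no t = level₃ (≮⇒≥ t , hi)

  parent-level : ∀ {i p c} → Child p c → AtLevel (suc i) c → AtLevel i p
  parent-level c (lo , hi) = child-≥⁻¹ c lo , child-<⁻¹ c hi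

  V₀ : ∀ {v} → AtLevel L v → V N v
  V₀ = V-level L (m≤n+m _ 3)

  V₁ : ∀ {v} → AtLevel (1 + L) v → V N v
  V₁ = V-level (1 + L) (m≤n+m _ 2)

  V₂ : ∀ {v} → AtLevel (2 + L) v → V N v
  V₂ = V-level (2 + L) (m≤n+m _ 1)

  V₃ : ∀ {v} → AtLevel (3 + L) v → V N v
  V₃ = V-level (3 + L) ≤-refl

  no-grandchild : ∀ {x v} → AtLevel (3 + L) x → V N v → ¬ Child x v
  no-grandchild (lo , _) (_ , hi) c = <⇒≱ hi (child-≥ c lo)

  transfer : ∀ {u v w} → Same N S u v → S w ≡ true → A N w u → Edge v w
  transfer same Sw a = edge-sym (proj₂ (proj₂ (Equivalence.to (same _ Sw) a)))

  -- The chosen child `l` of `u` is adjacent to `v`, so `v` is `u` or the twin of `l`. The twin is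
  -- on the last level, two levels below the chosen parent of `u`, and cannot be adjacent to it.
  same₂ : ∀ {u v} → AtLevel (2 + L) u → V N v → Same N S u v → u ≡ v
  same₂ {u} {v} lu Vv same with leaf-child lu
  ... | l , c , Sl with level-child (2 + L) c lu
  ...   | ll with twin-exists {2 + L} ll
  ...     | l′ , t with edge-cases t (transfer same Sl (V₃ ll , V₂ lu , edge-sym (child-edge c)))
  ...       | inj₁ c′        = child-injective c c′
  ...       | inj₂ (inj₂ c′) = contradiction c′ (no-grandchild ll Vv)
  ...       | inj₂ (inj₁ refl) with parent u
  ...         | q , d = contradiction
    (child-< (upward-edge (2 + L) (proj₂ lq) (above (2 + L) (proj₁ (Twin.levelʳ t)))
      (transfer same (chosen₁ lq) (V₁ lq , V₂ lu , child-edge d))) (proj₂ lq))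
    (≤⇒≯ (proj₁ (Twin.levelʳ t)))
    where
    lq : AtLevel (1 + L) q
    lq = parent-level {1 + L} d lu

  -- The chosen child `2 * u` is adjacent to `v`. Its twin is chosen too, which excludes it as `v`,
  -- and its children are on level `L + 2`, where `same₂` applies.
  same₀ : ∀ {u v} → AtLevel L u → V N v → S v ≡ false → Same N S u v → u ≡ v
  same₀ {u} {v} lu Vv Sv same with level-child L {u} (even refl) lu
  ... | lw with twin-exists {L} lw
  ...   | w′ , t with edge-cases t (transfer same (chosen₁ lw) (V₁ lw , V₀ lu , edge-sym (child-edge {u} (even refl))))
  ...     | inj₁ c           = child-injective {c = 2 * u} (even refl) c
  ...     | inj₂ (inj₁ refl) = case trans (sym Sv) (chosen₁ (Twin.levelʳ t)) of λ ()
  ...     | inj₂ (inj₂ c)    = sym (same₂ (level-child (1 + L) c lw) (V₀ lu) (same-sym {N} {S} same))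

  -- The twin of `u` is chosen and therefore adjacent to `v`. Its only neighbour besides `u` is its
  -- parent on level `L + 2`, where `same₂` applies.
  same₃ : ∀ {u v} → AtLevel (3 + L) u → V N v → S u ≡ false → Same N S u v → u ≡ v
  same₃ {u} {v} lu Vv Su same with twin-exists {2 + L} lu
  ... | u′ , t with edge-cases (twin-sym t)
                      (transfer same (leaf-twin t Su) (V₃ (Twin.levelʳ t) , V₃ lu , twin-edge (twin-sym t)))
  ...   | inj₁ c         = sym (same₂ (parent-level {2 + L} c (Twin.levelʳ t)) (V₃ lu) (same-sym {N} {S} same))
  ...   | inj₂ (inj₁ eq) = sym eq
  ...   | inj₂ (inj₂ c)  = contradiction c (no-grandchild (Twin.levelʳ t) Vv)

  step-LD : LD L (chosen L) → LD N S
  step-LD ld = record { dom = dom ; loc = loc }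
    where
    dom : ∀ v → V N v → S v ≡ false → ∃ λ u → S u ≡ true × A N u v
    dom v Vv Sv with band Vv
    ... | top v<K =
            let (u , Su , a) = LD.dom ld v (proj₁ Vv , v<K) (trans (sym (chosen-top v<K)) Sv) in
            u , trans (chosen-top (proj₂ (proj₁ a))) Su , A-weaken L a
    ... | level₀ l = 2 * v , chosen₁ l′ , V₁ l′ , Vv , edge-sym (child-edge {v} (even refl))
      where l′ = level-child L {v} (even refl) l
    ... | level₁ l = case trans (sym Sv) (chosen₁ l) of λ ()
    ... | level₂ l = let (p , c) = parent v ; lp = parent-level {1 + L} c l in
            p , chosen₁ lp , V₁ lp , Vv , child-edge c
    ... | level₃ l = let (v′ , t) = twin-exists {2 + L} l in
            v′ , leaf-twin t Sv , V₃ (Twin.levelʳ t) , Vv , edge-sym (twin-edge t)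
    loc : ∀ u v → V N u → V N v → S u ≡ false → S v ≡ false → u ≢ v → ¬ Same N S u v
    loc u v Vu Vv Su Sv u≢v same with band Vu | band Vv
    -- Level `L + 1` is all chosen, and on the other levels from `L` on one vertex of the pair
    -- suffices for the conclusion. Only pairs within the first `L` levels are left to the smaller
    -- set.
    ... | level₂ l | _        = u≢v (same₂ l Vv same)
    ... | _        | level₂ l = u≢v (sym (same₂ l Vu (same-sym {N} {S} same)))
    ... | level₀ l | _        = u≢v (same₀ l Vv Sv same)
    ... | _        | level₀ l = u≢v (sym (same₀ l Vu Su (same-sym {N} {S} same)))
    ... | level₃ l | _        = u≢v (same₃ l Vv Su same)
    ... | _        | level₃ l = u≢v (sym (same₃ l Vu Sv (same-sym {N} {S} same)))
    ... | level₁ l | _        = case trans (sym Su) (chosen₁ l) of λ ()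
    ... | _        | level₁ l = case trans (sym Sv) (chosen₁ l) of λ ()
    ... | top u<K  | top v<K  = LD.loc ld u v Vu′ Vv′
            (trans (sym (chosen-top u<K)) Su) (trans (sym (chosen-top v<K)) Sv) u≢v
            λ w Sw → mk⇔ (restrict Vv′ same Sw) (restrict Vu′ (same-sym {N} {S} same) Sw)
      where
      Vu′ : V L u
      Vu′ = proj₁ Vu , u<K
      Vv′ : V L v
      Vv′ = proj₁ Vv , v<K
      restrict : ∀ {u v w} → V L v → Same N S u v → chosen L w ≡ true → A L w u → A L w v
      restrict Vv same Sw a = proj₁ a , Vv , proj₂ (proj₂ (Equivalence.to
        (same _ (trans (chosen-top (proj₂ (proj₁ a))) Sw)) (A-weaken L a)))

  private f = χ ∘ S

  children₂ : ∀ {q} → AtLevel (1 + L) q → children f q ≡ 0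
  children₂ {q} l = cong₂ (λ x y → χ x + χ y)
    (chosen₂ (level-child (1 + L) {q} (even refl) l)) (chosen₂ (level-child (1 + L) {q} (odd refl) l))

  leaf-children : ∀ {m} → AtLevel (2 + L) m → children f m ≡ 1
  leaf-children {m} l with m <? 3 * 2 ^ (1 + L)
  ... | yes m< = cong₂ (λ x y → χ x + χ y)
    (trans (low-leaf (level-child (2 + L) {m} (even refl) l) (child-<3 {1 + L} {m} (even refl) m<)) (isEven-2* m))
    (trans (low-leaf (level-child (2 + L) {m} (odd refl) l) (child-<3 {1 + L} {m} (odd refl) m<)) (isEven-2*+1 m))
  ... | no m≮ = cong₂ (λ x y → χ x + χ y)
    (trans (high-leaf (level-child (2 + L) {m} (even refl) l) (child-≥3 {1 + L} {m} (even refl) (≮⇒≥ m≮)))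
      (cong not (isEven-2* m)))
    (trans (high-leaf (level-child (2 + L) {m} (odd refl) l) (child-≥3 {1 + L} {m} (odd refl) (≮⇒≥ m≮)))
      (cong not (isEven-2*+1 m)))

  -- The root, neither of its children, and one leaf below each child.
  block-count : ∀ {q} → AtLevel (1 + L) q → block f q ≡ 3
  block-count {q} l = cong₂ _+_ (cong₂ _+_ (cong χ (chosen₁ l)) (children₂ l))
    (cong₂ _+_ (leaf-children (level-child (1 + L) {q} (even refl) l))
               (leaf-children (level-child (1 + L) {q} (odd refl) l)))

  step-count : Σ< (2 ^ N) f ≡ Σ< K (χ ∘ chosen L) + K * 6
  step-count = begin
    Σ< (2 ^ N) f       ≡⟨ Σ-blocks K f ⟩
    Σ< K f + level K f + Σ< K (λ i → block f (2 * K + i) + block f (3 * K + i))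
      ≡⟨ cong₂ _+_ (cong₂ _+_
           (Σ-cong K λ i i<K → cong χ (chosen-top i<K))
           (trans (Σ-cong K λ i i<K → cong χ (chosen₀ (m≤m+n K i , +-monoʳ-< K (<-≤-trans i<K (m≤m+n K 0)))))
             (trans (Σ-const K 0) (*-zeroʳ K))))
           (trans (Σ-cong K λ i i<K → let t = low-twin L i i<K in
             cong₂ _+_ (block-count (Twin.levelˡ t)) (block-count (Twin.levelʳ t))) (Σ-const K 6)) ⟩
    Σ< K (χ ∘ chosen L) + 0 + K * 6   ≡⟨ cong (_+ K * 6) (+-identityʳ _) ⟩
    Σ< K (χ ∘ chosen L) + K * 6       ∎
    where open ≡-Reasoning

chosen-count : ∀ L → Σ< (2 ^ L) (χ ∘ chosen L) ≡ γ L
chosen-count 0 = refl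
chosen-count 1 = refl
chosen-count 2 = refl
chosen-count 3 = refl
chosen-count (suc (suc (suc (suc L)))) = trans (Step.step-count L) (cong (_+ 2 ^ L * 6) (chosen-count L))

-- Small cases of the construction

data Outside₃ : ℕ → Set where
  out₂ : Outside₃ 2
  out₃ : Outside₃ 3
  out₆ : Outside₃ 6
  out₇ : Outside₃ 7

outside₃ : ∀ v → V 3 v → chosen 3 v ≡ false → Outside₃ v
outside₃ 2 _ _ = out₂
outside₃ 3 _ _ = out₃
outside₃ 6 _ _ = out₆
outside₃ 7 _ _ = out₇
outside₃ (suc (suc (suc (suc (suc (suc (suc (suc v)))))))) (_ , lt) _ = contradiction (m≤m+n 8 v) (<⇒≱ lt)

-- The vertices 2, 3, 6, 7 have the chosen neighbours 1, 4, 5 and 1 and 4 and 5, respectively: all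
-- three for 2, and a different single one for each of the others.
base₃ : LD 3 (chosen 3)
base₃ = record
  { dom = λ v Vv Sv → dom (outside₃ v Vv Sv) Vv
  ; loc = λ u v Vu Vv Su Sv u≢v same → u≢v (loc (outside₃ u Vu Su) (outside₃ v Vv Sv) Vu Vv same)
  }
  where
  V₁ : V 3 1
  V₁ = s≤s z≤n , ≤ᵇ⇒≤ _ _ tt
  V₄ : V 3 4
  V₄ = s≤s z≤n , ≤ᵇ⇒≤ _ _ tt
  V₅ : V 3 5
  V₅ = s≤s z≤n , ≤ᵇ⇒≤ _ _ tt
  t₄₆ : Twin 1 4 6
  t₄₆ = twin-even top-twin
  t₅₇ : Twin 1 5 7
  t₅₇ = twin-odd top-twin
  dom : ∀ {v} → Outside₃ v → V 3 v → ∃ λ u → chosen 3 u ≡ true × A 3 u v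
  dom out₂ Vv = 1 , refl , V₁ , Vv , child-edge (even refl)
  dom out₃ Vv = 1 , refl , V₁ , Vv , child-edge (odd refl)
  dom out₆ Vv = 4 , refl , V₄ , Vv , twin-edge t₄₆
  dom out₇ Vv = 5 , refl , V₅ , Vv , twin-edge t₅₇
  by : ∀ {u v} w {X : Set} → chosen 3 w ≡ true → V 3 w → V 3 u → Edge w u → ¬ Edge w v → Same 3 (chosen 3) u v → X
  by w Sw Vw Vu e ne same = contradiction (proj₂ (proj₂ (Equivalence.to (same w Sw) (Vw , Vu , e)))) ne
  ¬43 : ¬ Edge 4 3
  ¬43 e with edge-cases (twin-sym top-twin) e
  ... | inj₁ (even ())
  ... | inj₁ (odd ())
  ... | inj₂ (inj₂ (even ()))
  ... | inj₂ (inj₂ (odd ()))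
  ¬16 : ¬ Edge 1 6
  ¬16 e with edge-cases (twin-sym t₄₆) e
  ... | inj₁ (even ())
  ... | inj₁ (odd ())
  ... | inj₂ (inj₂ (even ()))
  ... | inj₂ (inj₂ (odd ()))
  ¬17 : ¬ Edge 1 7
  ¬17 e with edge-cases (twin-sym t₅₇) e
  ... | inj₁ (even ())
  ... | inj₁ (odd ())
  ... | inj₂ (inj₂ (even ()))
  ... | inj₂ (inj₂ (odd ()))
  ¬47 : ¬ Edge 4 7
  ¬47 e with edge-cases (twin-sym t₅₇) e
  ... | inj₁ (even ())
  ... | inj₁ (odd ())
  ... | inj₂ (inj₂ (even ()))
  ... | inj₂ (inj₂ (odd ()))
  loc : ∀ {u v} → Outside₃ u → Outside₃ v → V 3 u → V 3 v → Same 3 (chosen 3) u v → u ≡ v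
  loc out₂ out₂ _ _ _ = refl
  loc out₃ out₃ _ _ _ = refl
  loc out₆ out₆ _ _ _ = refl
  loc out₇ out₇ _ _ _ = refl
  loc out₂ out₃ Vu _ same = by 4 refl V₄ Vu (edge-sym (child-edge (even refl))) ¬43 same
  loc out₂ out₆ Vu _ same = by 1 refl V₁ Vu (child-edge (even refl)) ¬16 same
  loc out₂ out₇ Vu _ same = by 1 refl V₁ Vu (child-edge (even refl)) ¬17 same
  loc out₃ out₆ Vu _ same = by 1 refl V₁ Vu (child-edge (odd refl)) ¬16 same
  loc out₃ out₇ Vu _ same = by 1 refl V₁ Vu (child-edge (odd refl)) ¬17 same
  loc out₆ out₇ Vu _ same = by 4 refl V₄ Vu (twin-edge t₄₆) ¬47 same
  loc out₃ out₂ Vu Vv same = sym (loc out₂ out₃ Vv Vu (same-sym {3} {chosen 3} same))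
  loc out₆ out₂ Vu Vv same = sym (loc out₂ out₆ Vv Vu (same-sym {3} {chosen 3} same))
  loc out₇ out₂ Vu Vv same = sym (loc out₂ out₇ Vv Vu (same-sym {3} {chosen 3} same))
  loc out₆ out₃ Vu Vv same = sym (loc out₃ out₆ Vv Vu (same-sym {3} {chosen 3} same))
  loc out₇ out₃ Vu Vv same = sym (loc out₃ out₇ Vv Vu (same-sym {3} {chosen 3} same))
  loc out₇ out₆ Vu Vv same = sym (loc out₆ out₇ Vv Vu (same-sym {3} {chosen 3} same))

base₂ : LD 2 (chosen 2)
base₂ = record
  { dom = dom
  ; loc = λ u v Vu Vv Su Sv u≢v _ → u≢v (trans (outside u Vu Su) (sym (outside v Vv Sv)))
  }
  where
  outside : ∀ v → V 2 v → chosen 2 v ≡ false → v ≡ 3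
  outside 3 _ _ = refl
  outside (suc (suc (suc (suc v)))) (_ , lt) _ = contradiction (m≤m+n 4 v) (<⇒≱ lt)
  dom : ∀ v → V 2 v → chosen 2 v ≡ false → ∃ λ u → chosen 2 u ≡ true × A 2 u v
  dom v Vv Sv with outside v Vv Sv
  ... | refl = 1 , refl , triangle 1 3 (s≤s z≤n , s≤s (s≤s z≤n)) Vv λ ()

base₁ : LD 1 (chosen 1)
base₁ = record
  { dom = λ v Vv Sv → ⊥-elim (inside v Vv Sv)
  ; loc = λ u v Vu _ Su _ _ _ → inside u Vu Su
  }
  where
  inside : ∀ v → V 1 v → chosen 1 v ≡ false → ⊥
  inside (suc (suc v)) (_ , lt) _ = <⇒≱ lt (m≤m+n 2 v)

base₀ : LD 0 (chosen 0)
base₀ = record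
  { dom = λ v Vv _ → contradiction (proj₁ Vv) (<⇒≱ (proj₂ Vv))
  ; loc = λ u v Vu _ _ _ _ _ → <⇒≱ (proj₂ Vu) (proj₁ Vu)
  }

chosen-LD : ∀ L → LD L (chosen L)
chosen-LD 0 = base₀
chosen-LD 1 = base₁
chosen-LD 2 = base₂
chosen-LD 3 = base₃
chosen-LD (suc (suc (suc (suc L)))) = Step.step-LD L (chosen-LD L)

-- The label 0 is in the range of `upTo` but is not a vertex, so it must be kept out of
-- `chosenList`.
chosen-0 : ∀ L → chosen L 0 ≡ false
chosen-0 0 = refl
chosen-0 1 = refl
chosen-0 2 = refl
chosen-0 3 = refl
chosen-0 (suc (suc (suc (suc L)))) = trans (Step.chosen-top L (1≤2^ L)) (chosen-0 L)

-- Lists and predicates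

member : List ℕ → ℕ → Bool
member S v = does (v ∈? S)

∈⇒member : ∀ S {v} → v ∈ S → member S v ≡ true
∈⇒member S {v} p with v ∈? S
... | yes _ = refl
... | no ¬p = contradiction p ¬p

member-LD : ∀ n S → IsLocDom n S → LD (suc n) (member S)
member-LD n S (_ , _ , dom , loc) = record
  { dom = λ v Vv Sv → let (u , u∈S , a) = find (dom v Vv (∉S Sv)) in u , ∈⇒member S u∈S , a
  ; loc = λ u v Vu Vv Su Sv u≢v same → loc u v Vu Vv (∉S Su) (∉S Sv) u≢v λ w w∈S → same w (∈⇒member S w∈S)
  }
  where
  ∉S : ∀ {v} → member S v ≡ false → v ∉ S
  ∉S e v∈S = case trans (sym e) (∈⇒member S v∈S) of λ ()

Σ-≡ᵇ : ∀ N x → Σ< N (λ v → χ (v ≡ᵇ x)) ≤ 1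
Σ-≡ᵇ zero    x       = z≤n
Σ-≡ᵇ (suc N) zero    = s≤s (≤-reflexive (trans (Σ-const N 0) (*-zeroʳ N)))
Σ-≡ᵇ (suc N) (suc x) = Σ-≡ᵇ N x

member-count : ∀ N S → Σ< N (χ ∘ member S) ≤ length S
member-count N []      = ≤-reflexive (trans (Σ-const N 0) (*-zeroʳ N))
member-count N (x ∷ S) = begin
  -- `member (x ∷ S) v` computes to the disjunction of `v ≡ᵇ x` and `member S v`.
  Σ< N (χ ∘ member (x ∷ S))                          ≤⟨ Σ-mono N (λ v _ → χ-∨ (v ≡ᵇ x) (member S v)) ⟩
  Σ< N (λ v → χ (v ≡ᵇ x) + χ (member S v))           ≡⟨ Σ-distrib-+ N _ _ ⟩
  Σ< N (λ v → χ (v ≡ᵇ x)) + Σ< N (χ ∘ member S)      ≤⟨ +-mono-≤ (Σ-≡ᵇ N x) (member-count N S) ⟩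
  suc (length S)                                     ∎
  where
  open ≤-Reasoning
  χ-∨ : ∀ x y → χ (x ∨ y) ≤ χ x + χ y
  χ-∨ true  _ = s≤s z≤n
  χ-∨ false _ = ≤-refl

chosen? : ∀ L v → Dec (chosen L v ≡ true)
chosen? L v = chosen L v Bool.≟ true

chosenList : ℕ → List ℕ
chosenList L = filter (chosen? L) (upTo (2 ^ L))

-- The general `g` is for the induction, which passes to `g ∘ suc`; `upTo` is the case `g = id`.
length-filter : ∀ (s : ℕ → Bool) N g →
  length (filter (λ v → s v Bool.≟ true) (applyUpTo g N)) ≡ Σ< N (χ ∘ s ∘ g)
length-filter s zero    g = refl
length-filter s (suc N) g with s (g 0)
... | true  = cong suc (length-filter s N (g ∘ suc))
... | false = length-filter s N (g ∘ suc)

chosenList-length : ∀ L → length (chosenList L) ≡ γ L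
chosenList-length L = trans (length-filter (chosen L) (2 ^ L) id) (chosen-count L)

chosenList-LD : ∀ n → IsLocDom n (chosenList (suc n))
chosenList-LD n =
    filter⁺ (chosen? L) (upTo⁺ (2 ^ L))
  , All.tabulate vertex
  , (λ v Vv v∉S → let (u , Su , a) = LD.dom ld v Vv (unchosen Vv v∉S) in lose (listed (proj₁ a) Su) a)
  , λ u v Vu Vv u∉S v∉S u≢v same → LD.loc ld u v Vu Vv (unchosen Vu u∉S) (unchosen Vv v∉S) u≢v
      λ w Sw → mk⇔ (λ a → Equivalence.to (same w (listed (proj₁ a) Sw)) a)
                   (λ a → Equivalence.from (same w (listed (proj₁ a) Sw)) a)
  where
  L = suc n
  ld = chosen-LD L
  listed : ∀ {v} → V L v → chosen L v ≡ true → v ∈ chosenList L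
  listed Vv Sv = ∈-filter⁺ (chosen? L) (∈-upTo⁺ (proj₂ Vv)) Sv
  unchosen : ∀ {v} → V L v → v ∉ chosenList L → chosen L v ≡ false
  unchosen {v} Vv v∉S with chosen L v in eq
  ... | false = refl
  ... | true  = contradiction (listed Vv eq) v∉S
  positive : ∀ v → chosen L v ≡ true → 1 ≤ v
  positive zero    e = case trans (sym e) (chosen-0 L) of λ ()
  positive (suc _) _ = s≤s z≤n
  vertex : ∀ {v} → v ∈ chosenList L → V L v
  vertex {v} v∈S = let (v∈up , Sv) = ∈-filter⁻ (chosen? L) {xs = upTo (2 ^ L)} v∈S in positive v Sv , ∈-upTo⁻ v∈up

locDomNumber : ∀ n → LocDomNumber n (γ (suc n))
locDomNumber n = (chosenList (suc n) , chosenList-LD n , chosenList-length (suc n)) ,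
  λ S ld → ≤-trans (lower (suc n) (member S) (member-LD n S ld)) (member-count (2 ^ suc n) S)

-- The closed form and the theorem

-- Since 5 * 6K = 2 * 16K - 2K for K = 2 ^ L, the difference of `γ L * 5` and `2 * 2 ^ L` depends
-- only on `L` modulo 4. Its values -2, 1, 2, -1 are read off at `L` from 0 to 3 and put on the side
-- where they are added.
γ-closed : ∀ k →
  (γ (k * 4) * 5 + 2 ≡ 2 * 2 ^ (k * 4)) × (γ (1 + k * 4) * 5 ≡ 2 * 2 ^ (1 + k * 4) + 1) ×
  (γ (2 + k * 4) * 5 ≡ 2 * 2 ^ (2 + k * 4) + 2) × (γ (3 + k * 4) * 5 + 1 ≡ 2 * 2 ^ (3 + k * 4))
γ-closed zero    = refl , refl , refl , refl
γ-closed (suc k) = let (a , b , c , d) = γ-closed k in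
    deficit (γ (k * 4)) (2 ^ (k * 4)) 2 a
  , excess (γ (1 + k * 4)) (2 ^ (1 + k * 4)) 1 b
  , excess (γ (2 + k * 4)) (2 ^ (2 + k * 4)) 2 c
  , deficit (γ (3 + k * 4)) (2 ^ (3 + k * 4)) 1 d
  where
  deficit : ∀ g K e → g * 5 + e ≡ 2 * K → (g + K * 6) * 5 + e ≡ 2 * (2 * (2 * (2 * (2 * K))))
  deficit g K e eq = trans (expand g K e) (trans (cong (_+ K * 30) eq) (collect K))
    where
    expand : ∀ g K e → (g + K * 6) * 5 + e ≡ g * 5 + e + K * 30
    expand = solve-∀
    collect : ∀ K → 2 * K + K * 30 ≡ 2 * (2 * (2 * (2 * (2 * K))))
    collect = solve-∀
  excess : ∀ g K e → g * 5 ≡ 2 * K + e → (g + K * 6) * 5 ≡ 2 * (2 * (2 * (2 * (2 * K)))) + e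
  excess g K e eq = trans (expand g K) (trans (cong (_+ K * 30) eq) (collect K e))
    where
    expand : ∀ g K → (g + K * 6) * 5 ≡ g * 5 + K * 30
    expand = solve-∀
    collect : ∀ K e → 2 * K + e + K * 30 ≡ 2 * (2 * (2 * (2 * (2 * K)))) + e
    collect = solve-∀

γ-quotient : ∀ n {x} → γ (suc n) * 5 ≡ x → LocDomNumber n (x / 5)
γ-quotient n refl = subst (LocDomNumber n) (sym (m*n/n≡m (γ (suc n)) 5)) (locDomNumber n)

theorem3 : ∀ n → 1 ≤ n →
    (n % 4 ≡ 0 → LocDomNumber n ((2 ^ (n + 2) + 1) / 5)) ×
    (n % 4 ≡ 1 → LocDomNumber n ((2 ^ (n + 2) + 2) / 5)) ×
    (n % 4 ≡ 2 → LocDomNumber n ((2 ^ (n + 2) ∸ 1) / 5)) ×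
    (n % 4 ≡ 3 → LocDomNumber n ((2 ^ (n + 2) ∸ 2) / 5))
-- The number of levels is `n + 1`, so residues shift by one, and for `n` congruent to 3 it is
-- `suc k * 4`.
theorem3 n _ = let (_ , c₀ , c₁ , c₂) = γ-closed k ; (c₃ , _) = γ-closed (suc k) in
    (λ r → γ-quotient n (trans (at (λ L → γ L * 5 ≡ 2 * 2 ^ L + 1) r c₀) (cong (_+ 1) power)))
  , (λ r → γ-quotient n (trans (at (λ L → γ L * 5 ≡ 2 * 2 ^ L + 2) r c₁) (cong (_+ 2) power)))
  , (λ r → γ-quotient n (minus 1 (at (λ L → γ L * 5 + 1 ≡ 2 * 2 ^ L) r c₂)))
  , (λ r → γ-quotient n (minus 2 (at (λ L → γ L * 5 + 2 ≡ 2 * 2 ^ L) r c₃)))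
  where
  k = n / 4
  at : ∀ (P : ℕ → Set) {r} → n % 4 ≡ r → P (suc (r + k * 4)) → P (suc n)
  at P e = subst (P ∘ suc) (sym (trans (m≡m%n+[m/n]*n n 4) (cong (_+ k * 4) e)))
  power : 2 * 2 ^ suc n ≡ 2 ^ (n + 2)
  power = cong (2 ^_) (+-comm 2 n)
  minus : ∀ e → γ (suc n) * 5 + e ≡ 2 * 2 ^ suc n → γ (suc n) * 5 ≡ 2 ^ (n + 2) ∸ e
  minus e eq = trans (sym (m+n∸n≡m _ e)) (cong (_∸ e) (trans eq power))
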